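{- Let the matching graph be complete, i.e. $\mathcal E=\mathcal D\times\mathcal S$, with any numbers $n_{\mathcal D}\ge 1$ and $n_{\mathcal S}\ge 1$ of demand and supply nodes. Then the optimal control for the average cost problem is to match everything: the stationary policy $\pi$ using the decision rule $u_x$ with $x-u_x=0$ for every $x\in\mathcal Q$ satisfies $g^{\pi}(y)=g^\ast(y)$ for all $y\in\mathcal Y$.
   Context: Matching model. $(\mathcal D\cup\mathcal S,\mathcal E)$ is a finite bipartite graph with demand nodes $\mathcal D=\{d_1,\dots,d_{n_{\mathcal D}}\}$, supply nodes $\mathcal S=\{s_1,\dots,s_{n_{\mathcal S}}\}$ and allowed matching pairs $\mathcal E\subset\mathcal D\times\mathcal S$. A pair $(i,j)$ stands for $(d_i,s_j)$, and indices are identified with nodes. $\mathcal S(i)=\{j:(i,j)\in\mathcal E\}$, $\mathcal D(j)=\{i:(i,j)\in\mathcal E\}$, and $\mathcal S(D)=\bigcup_{i\in D}\mathcal S(i)$, $\mathcal D(S)=\bigcup_{j\in S}\mathcal D(j)$. For a node $k$, $e_k\in\mathbb N^{n_{\mathcal D}+n_{\mathcal S}}$ is the unit vector ($\mathbb N=\{0,1,\dots\}$), and $e_{(i,j)}=e_{d_i}+e_{s_j}$. $\mathcal A=\mathcal D\times\mathcal S$ is the set of arrival pairs, $(i,j)\in\mathcal A$ being identified with $e_{(i,j)}$. At each time an arrival, independent and distributed as a random variable $A$, occurs: $\mathbb P(A=e_{(i,j)})=\alpha_i\beta_j>0$, $\sum_i\alpha_i=\sum_j\beta_j=1$. Stability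 condition: for all nonempty $D\subsetneq\mathcal D$ and nonempty $S\subsetneq\mathcal S$, $\sum_{i\in D}\alpha_i<\sum_{j\in\mathcal S(D)}\beta_j$ and $\sum_{j\in S}\beta_j<\sum_{i\in\mathcal D(S)}\alpha_i$. States: $\mathcal Q=\{q\in\mathbb N^{n_{\mathcal D}+n_{\mathcal S}}:\sum_{k\in\mathcal D}q_k=\sum_{k\in\mathcal S}q_k\}$, $\mathcal Y=\mathcal Q\times\mathcal A$. For $x\in\mathcal Q$, the set of admissible matchings $U_x$ is the set of $u=\sum_{(i,j)\in\mathcal E}u_{(i,j)}e_{(i,j)}$ with $u_{(i,j)}\in\mathbb N$ (the number of matchings in edge $(i,j)$), $\sum_{k\in\mathcal S(i)}u_{(i,k)}\le x_{d_i}$ for all $i$ and $\sum_{k\in\mathcal D(j)}u_{(k,j)}\le x_{s_j}$ for all $j$. Dynamics and costs: a decision rule maps each $x\in\mathcal Q$ to some $u_x\in U_x$. A policy $\pi$ is a sequence of decision rules; it is stationary if the same rule is used at all times. The process is $Y(n)=(Q(n),A(n))$, with $X(n)=Q(n)+A(n)$ and $Q(n+1)=X(n)-u$, where $u\in U_{X(n)}$ is the matching chosen by the rule used at time $n$ in $X(n)$; $Y(0)=y$. The cost in state $y=(q,a)$ is $c(y)=c(x)=\sum_{k\in\mathcal D\cup\mathcal S}c_kx_k$ with $x=q+a$ and all $c_k>0$. Average cost: $g^\pi(y)=\limsup_{N\to\infty}\frac1N\sum_{n=0}^{N-1}\mathbb E_y^\pi[c(Y(n))]$ and $g^\ast(y)=\inf_\pi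 g^\pi(y)$, the infimum being over all policies. -}

module Defs where

open import Algebra.Bundles.Raw using (RawMonoid)
import Algebra.Definitions.RawMonoid as RawMonoidDefs
import Algebra.Properties.CommutativeMonoid.Sum as SumProperties
open import Data.Bool.Base using (Bool; true; false; if_then_else_)
open import Data.Fin.Base as Fin using (Fin; _↑ˡ_; _↑ʳ_; toℕ)
import Data.Fin.Properties as Fin
open import Data.Fin.Subset using (Subset; ⊤; _⊂_; Nonempty; ⋃)
open import Data.Fin.Subset.Properties using (_∈?_)
open import Data.Integer.Base using (+_)
import Data.List.Base as List
open import Data.Nat.Base as ℕ using (ℕ; zero; suc; _∸_)
import Data.Nat.Properties as ℕ
open import Data.Product.Base using (Σ; ∃; _×_; _,_; proj₁; proj₂)
open import Data.Rational.Base as ℚ using (ℚ; 0ℚ; 1ℚ; ½; ∣_∣)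
import Data.Rational.Properties as ℚ
open import Data.Rational.Solver using (module +-*-Solver)
open import Data.Sum.Base using (inj₁; inj₂)
open import Data.Vec.Base as Vec
  using (Vec; []; _∷_; lookup; tabulate; replicate; zipWith; _[_]≔_)
open import Data.Vec.Functional using (Vector)
import Data.Vec.Properties as Vec
open import Function.Base using (const)
open import Level using (Level; 0ℓ)
open import Relation.Binary.PropositionalEquality
  using (_≡_; _≢_; refl; sym; trans; cong; cong₂; subst; module ≡-Reasoning)
open import Relation.Nullary.Negation using (contradiction)
open import Relation.Nullary.Decidable using (yes; no)

module FiniteSum {a ℓ : Level} (M : RawMonoid a ℓ) where
  open RawMonoid M using (Carrier; ε)

  ∑ : ∀ {n} → Vector Carrier n → Carrier
  ∑ = RawMonoidDefs.sum M

  ∑∈ : ∀ {n} → Subset n → Vector Carrier n → Carrier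
  ∑∈ p f = ∑ (λ k → if lookup p k then f k else ε)

open FiniteSum ℕ.+-0-rawMonoid using () renaming (∑ to ∑ℕ; ∑∈ to ∑ℕ∈)

-- Cauchy sequences of rationals.  The witness of `cauchy` contains a modulus
-- of convergence.  Equality of reals is _≈ℝ_, not _≡_.

record ℝ : Set where
  constructor mkℝ
  field
    seq    : ℕ → ℚ
    cauchy : ∀ ε → 0ℚ ℚ.< ε →
             ∃ λ N → ∀ m n → N ℕ.≤ m → N ℕ.≤ n → ∣ seq m ℚ.- seq n ∣ ℚ.< ε

open ℝ public

infix 4 _≈ℝ_ _<ℝ_

_≈ℝ_ : ℝ → ℝ → Set
x ≈ℝ y = ∀ ε → 0ℚ ℚ.< ε →
         ∃ λ N → ∀ n → N ℕ.≤ n → ∣ seq x n ℚ.- seq y n ∣ ℚ.< ε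

_<ℝ_ : ℝ → ℝ → Set
x <ℝ y = ∃ λ ε → 0ℚ ℚ.< ε ×
         ∃ λ N → ∀ n → N ℕ.≤ n → seq x n ℚ.+ ε ℚ.≤ seq y n

fromℚ : ℚ → ℝ
fromℚ q = mkℝ (const q) λ ε 0<ε →
  0 , λ _ _ _ _ → subst (ℚ._< ε) (sym (cong ∣_∣ (ℚ.+-inverseʳ q))) 0<ε

fromℕ : ℕ → ℝ
fromℕ n = fromℚ (+ n ℚ./ 1)

0ℝ 1ℝ : ℝ
0ℝ = fromℚ 0ℚ
1ℝ = fromℚ 1ℚ

private
  open +-*-Solver

  half-pos : ∀ {ε} → 0ℚ ℚ.< ε → 0ℚ ℚ.< ½ ℚ.* ε
  half-pos 0<ε = ℚ.<-respˡ-≡ (ℚ.*-zeroʳ ½) (ℚ.*-monoʳ-<-pos ½ 0<ε)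

  half+half : ∀ ε → ½ ℚ.* ε ℚ.+ ½ ℚ.* ε ≡ ε
  half+half ε = trans (sym (ℚ.*-distribʳ-+ ε ½ ½)) (ℚ.*-identityˡ ε)

  bounded : (x : ℝ) → ∃ λ B → 0ℚ ℚ.< B ×
            ∃ λ N → ∀ n → N ℕ.≤ n → ∣ seq x n ∣ ℚ.≤ B
  bounded x with cauchy x 1ℚ (ℚ.positive⁻¹ 1ℚ)
  ... | N , close =
    1ℚ ℚ.+ ∣ seq x N ∣ ,
    ℚ.+-mono-<-≤ (ℚ.positive⁻¹ 1ℚ) (ℚ.0≤∣p∣ (seq x N)) ,
    N , λ n N≤n → let open ℚ.≤-Reasoning in begin
      ∣ seq x n ∣
        ≡⟨ cong ∣_∣ (solve 2 (λ a b → a := (a :+ :- b) :+ b) refl (seq x n) (seq x N)) ⟩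
      ∣ (seq x n ℚ.- seq x N) ℚ.+ seq x N ∣
        ≤⟨ ℚ.∣p+q∣≤∣p∣+∣q∣ (seq x n ℚ.- seq x N) (seq x N) ⟩
      ∣ seq x n ℚ.- seq x N ∣ ℚ.+ ∣ seq x N ∣
        ≤⟨ ℚ.+-monoˡ-≤ ∣ seq x N ∣ (ℚ.<⇒≤ (close n N N≤n ℕ.≤-refl)) ⟩
      1ℚ ℚ.+ ∣ seq x N ∣ ∎

  sum-close : ∀ a b c d {δ₁ δ₂} → ∣ a ℚ.- c ∣ ℚ.< δ₁ → ∣ b ℚ.- d ∣ ℚ.< δ₂ →
              ∣ (a ℚ.+ b) ℚ.- (c ℚ.+ d) ∣ ℚ.< δ₁ ℚ.+ δ₂
  sum-close a b c d {δ₁} {δ₂} ac bd = let open ℚ.≤-Reasoning in begin-strict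
    ∣ (a ℚ.+ b) ℚ.- (c ℚ.+ d) ∣
      ≡⟨ cong ∣_∣ (solve 4 (λ a b c d →
           (a :+ b) :+ :- (c :+ d) := (a :+ :- c) :+ (b :+ :- d)) refl a b c d) ⟩
    ∣ (a ℚ.- c) ℚ.+ (b ℚ.- d) ∣
      ≤⟨ ℚ.∣p+q∣≤∣p∣+∣q∣ (a ℚ.- c) (b ℚ.- d) ⟩
    ∣ a ℚ.- c ∣ ℚ.+ ∣ b ℚ.- d ∣
      <⟨ ℚ.+-mono-< ac bd ⟩
    δ₁ ℚ.+ δ₂ ∎

  product-bound : ∀ p q C δ → 0ℚ ℚ.< C → ∣ p ∣ ℚ.≤ C → ∣ q ∣ ℚ.< δ → ∣ p ℚ.* q ∣ ℚ.< C ℚ.* δ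
  product-bound p q C δ 0<C p≤C q<δ = let open ℚ.≤-Reasoning in begin-strict
    ∣ p ℚ.* q ∣      ≡⟨ ℚ.∣p*q∣≡∣p∣*∣q∣ p q ⟩
    ∣ p ∣ ℚ.* ∣ q ∣  ≤⟨ ℚ.*-monoʳ-≤-nonNeg ∣ q ∣ {{ℚ.∣-∣-nonNeg q}} p≤C ⟩
    C ℚ.* ∣ q ∣      <⟨ ℚ.*-monoʳ-<-pos C {{ℚ.positive 0<C}} q<δ ⟩
    C ℚ.* δ          ∎

  product-close : ∀ a b c d A B δ → 0ℚ ℚ.< A → 0ℚ ℚ.< B → ∣ a ∣ ℚ.≤ A → ∣ d ∣ ℚ.≤ B →
                  ∣ b ℚ.- d ∣ ℚ.< δ → ∣ a ℚ.- c ∣ ℚ.< δ →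
                  ∣ a ℚ.* b ℚ.- c ℚ.* d ∣ ℚ.< A ℚ.* δ ℚ.+ B ℚ.* δ
  product-close a b c d A B δ 0<A 0<B a≤A d≤B bd ac = let open ℚ.≤-Reasoning in begin-strict
    ∣ a ℚ.* b ℚ.- c ℚ.* d ∣
      ≡⟨ cong ∣_∣ (solve 4 (λ a b c d →
           a :* b :+ :- (c :* d) := a :* (b :+ :- d) :+ d :* (a :+ :- c)) refl a b c d) ⟩
    ∣ a ℚ.* (b ℚ.- d) ℚ.+ d ℚ.* (a ℚ.- c) ∣
      ≤⟨ ℚ.∣p+q∣≤∣p∣+∣q∣ (a ℚ.* (b ℚ.- d)) (d ℚ.* (a ℚ.- c)) ⟩
    ∣ a ℚ.* (b ℚ.- d) ∣ ℚ.+ ∣ d ℚ.* (a ℚ.- c) ∣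
      <⟨ ℚ.+-mono-< (product-bound a (b ℚ.- d) A δ 0<A a≤A bd)
                    (product-bound d (a ℚ.- c) B δ 0<B d≤B ac) ⟩
    A ℚ.* δ ℚ.+ B ℚ.* δ ∎

  divide : ∀ C ε → 0ℚ ℚ.< C → 0ℚ ℚ.< ε → ∃ λ δ → 0ℚ ℚ.< δ × C ℚ.* δ ≡ ε
  divide C ε 0<C 0<ε =
    r ℚ.* ε ,
    ℚ.<-respˡ-≡ (ℚ.*-zeroʳ r) (ℚ.*-monoʳ-<-pos r {{ℚ.1/pos⇒pos C}} 0<ε) ,
    trans (sym (ℚ.*-assoc C r ε))
      (trans (cong (ℚ._* ε) (ℚ.*-inverseʳ C)) (ℚ.*-identityˡ ε))
    where
    instance
      C⁺ : ℚ.Positive C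
      C⁺ = ℚ.positive 0<C

      C≢0 : ℚ.NonZero C
      C≢0 = ℚ.pos⇒nonZero C

    r : ℚ
    r = ℚ.1/ C

infixl 6 _+ℝ_
infixl 7 _*ℝ_

_+ℝ_ : ℝ → ℝ → ℝ
seq    (x +ℝ y) n = seq x n ℚ.+ seq y n
cauchy (x +ℝ y) ε 0<ε
  with cauchy x (½ ℚ.* ε) (half-pos 0<ε) | cauchy y (½ ℚ.* ε) (half-pos 0<ε)
... | M , closeˣ | N , closeʸ =
  M ℕ.⊔ N , λ m n K≤m K≤n → ℚ.<-respʳ-≡ (half+half ε)
    (sum-close (seq x m) (seq y m) (seq x n) (seq y n)
      (closeˣ m n (ℕ.m⊔n≤o⇒m≤o M N K≤m) (ℕ.m⊔n≤o⇒m≤o M N K≤n))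
      (closeʸ m n (ℕ.m⊔n≤o⇒n≤o M N K≤m) (ℕ.m⊔n≤o⇒n≤o M N K≤n)))

_*ℝ_ : ℝ → ℝ → ℝ
seq    (x *ℝ y) n = seq x n ℚ.* seq y n
cauchy (x *ℝ y) ε 0<ε =
  let A , 0<A , I , boundˣ = bounded x
      B , 0<B , J , boundʸ = bounded y
      δ , 0<δ , [A+B]δ≡ε   = divide (A ℚ.+ B) ε (ℚ.+-mono-< 0<A 0<B) 0<ε
      M , closeˣ           = cauchy x δ 0<δ
      N , closeʸ           = cauchy y δ 0<δ
  in
  (I ℕ.⊔ J) ℕ.⊔ (M ℕ.⊔ N) , λ m n K≤m K≤n →
  let I⊔J≤m = ℕ.m⊔n≤o⇒m≤o (I ℕ.⊔ J) (M ℕ.⊔ N) K≤m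
      I⊔J≤n = ℕ.m⊔n≤o⇒m≤o (I ℕ.⊔ J) (M ℕ.⊔ N) K≤n
      M⊔N≤m = ℕ.m⊔n≤o⇒n≤o (I ℕ.⊔ J) (M ℕ.⊔ N) K≤m
      M⊔N≤n = ℕ.m⊔n≤o⇒n≤o (I ℕ.⊔ J) (M ℕ.⊔ N) K≤n
  in
  ℚ.<-respʳ-≡ (trans (sym (ℚ.*-distribʳ-+ δ A B)) [A+B]δ≡ε)
    (product-close (seq x m) (seq y m) (seq x n) (seq y n) A B δ 0<A 0<B
      (boundˣ m (ℕ.m⊔n≤o⇒m≤o I J I⊔J≤m))
      (boundʸ n (ℕ.m⊔n≤o⇒n≤o I J I⊔J≤n))
      (closeʸ m n (ℕ.m⊔n≤o⇒n≤o M N M⊔N≤m) (ℕ.m⊔n≤o⇒n≤o M N M⊔N≤n))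
      (closeˣ m n (ℕ.m⊔n≤o⇒m≤o M N M⊔N≤m) (ℕ.m⊔n≤o⇒m≤o M N M⊔N≤n)))

ℝ-+-rawMonoid : RawMonoid 0ℓ 0ℓ
ℝ-+-rawMonoid = record { Carrier = ℝ ; _≈_ = _≈ℝ_ ; _∙_ = _+ℝ_ ; ε = 0ℝ }

open FiniteSum ℝ-+-rawMonoid public using () renaming (∑ to ∑ℝ; ∑∈ to ∑ℝ∈)

-- An element v of [-∞,∞] is given by the set Below = {q ∈ ℚ : v < q}, which can be
-- any upward closed set of rationals without a least element (the empty set
-- is ∞, the full set is -∞).  In this representation arbitrary suprema and
-- infima exist constructively.

record ℝ̄ : Set₁ where
  field
    Below   : ℚ → Set
    upward  : ∀ {p q} → p ℚ.< q → Below p → Below q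
    rounded : ∀ {q} → Below q → ∃ λ p → p ℚ.< q × Below p

open ℝ̄ public

infix 4 _≤∞_ _≈∞_

_≤∞_ : ℝ̄ → ℝ̄ → Set
v ≤∞ w = ∀ q → Below w q → Below v q

_≈∞_ : ℝ̄ → ℝ̄ → Set
v ≈∞ w = v ≤∞ w × w ≤∞ v

ι : ℝ → ℝ̄
Below  (ι x) q = x <ℝ fromℚ q
upward (ι x) p<q (ε , 0<ε , N , below) =
  ε , 0<ε , N , λ n N≤n → ℚ.≤-trans (below n N≤n) (ℚ.<⇒≤ p<q)
rounded (ι x) {q} (ε , 0<ε , N , below) =
  q ℚ.- h ,
  ℚ.<-respʳ-≡ (ℚ.+-identityʳ q) (ℚ.+-monoʳ-< q (ℚ.neg-antimono-< (half-pos 0<ε))) ,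
  h , half-pos 0<ε , N , λ n N≤n → let open ℚ.≤-Reasoning in begin
    seq x n ℚ.+ h
      ≡⟨ solve 2 (λ a h → a :+ h := (a :+ (h :+ h)) :+ :- h) refl (seq x n) h ⟩
    (seq x n ℚ.+ (h ℚ.+ h)) ℚ.- h
      ≡⟨ cong (λ e → (seq x n ℚ.+ e) ℚ.- h) (half+half ε) ⟩
    (seq x n ℚ.+ ε) ℚ.- h
      ≤⟨ ℚ.+-monoˡ-≤ (ℚ.- h) (below n N≤n) ⟩
    q ℚ.- h ∎
  where
  h : ℚ
  h = ½ ℚ.* ε

inf : {I : Set} → (I → ℝ̄) → ℝ̄
Below  (inf v) q = ∃ λ i → Below (v i) q
upward (inf v) p<q (i , b) = i , upward (v i) p<q b
rounded (inf v) (i , b) with rounded (v i) b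
... | p , p<q , b′ = p , p<q , i , b′

-- The intermediate p is needed: v i < q for all i only gives supᵢ v i ≤ q.
sup : {I : Set} → (I → ℝ̄) → ℝ̄
Below  (sup v) q = ∃ λ p → p ℚ.< q × (∀ i → Below (v i) p)
upward (sup v) p<q (r , r<p , b) = r , ℚ.<-trans r<p p<q , b
rounded (sup v) (p , p<q , b) with ℚ.<-dense p<q
... | r , p<r , r<q = r , r<q , p , p<r , b

inf-lower : {I : Set} (v : I → ℝ̄) → ∀ i → inf v ≤∞ v i
inf-lower v i q b = i , b

inf-greatest : {I : Set} (v : I → ℝ̄) (w : ℝ̄) → (∀ i → w ≤∞ v i) → w ≤∞ inf v
inf-greatest v w w≤v q (i , b) = w≤v i q b

sup-upper : {I : Set} (v : I → ℝ̄) → ∀ i → v i ≤∞ sup v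
sup-upper v i q (p , p<q , b) = upward (v i) p<q (b i)

sup-least : {I : Set} (v : I → ℝ̄) (w : ℝ̄) → (∀ i → v i ≤∞ w) → sup v ≤∞ w
sup-least v w v≤w q b with rounded w b
... | p , p<q , b′ = p , p<q , λ i → v≤w i p b′

limsup : (ℕ → ℝ) → ℝ̄
limsup s = inf λ N → sup λ k → ι (s (N ℕ.+ k))

record BipartiteGraph : Set where
  field
    n𝒟 n𝒮 : ℕ
    edge  : Fin n𝒟 → Fin n𝒮 → Bool

  𝒟 𝒮 Node : Set
  𝒟    = Fin n𝒟
  𝒮    = Fin n𝒮
  Node = Fin (n𝒟 ℕ.+ n𝒮)

  d : 𝒟 → Node
  d i = i ↑ˡ n𝒮

  s : 𝒮 → Node
  s j = n𝒟 ↑ʳ j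

  𝒮⟨_⟩ : 𝒟 → Subset n𝒮
  𝒮⟨ i ⟩ = tabulate (edge i)

  𝒟⟨_⟩ : 𝒮 → Subset n𝒟
  𝒟⟨ j ⟩ = tabulate (λ i → edge i j)

  𝒮[_] : Subset n𝒟 → Subset n𝒮
  𝒮[ D ] = ⋃ (List.map 𝒮⟨_⟩ (List.filter (_∈? D) (List.allFin n𝒟)))

  𝒟[_] : Subset n𝒮 → Subset n𝒟
  𝒟[ S ] = ⋃ (List.map 𝒟⟨_⟩ (List.filter (_∈? S) (List.allFin n𝒮)))

  Complete : Set
  Complete = ∀ i j → edge i j ≡ true

  NodeVec : Set
  NodeVec = Vec ℕ (n𝒟 ℕ.+ n𝒮)

  infixl 6 _⊕_ _⊖_
  infixr 7 _•_

  𝟘 : NodeVec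
  𝟘 = replicate _ 0

  _⊕_ _⊖_ : NodeVec → NodeVec → NodeVec
  _⊕_ = zipWith ℕ._+_
  -- Truncated subtraction; only used for admissible u, where u ≤ x (see `u≤x`).
  _⊖_ = zipWith _∸_

  _•_ : ℕ → NodeVec → NodeVec
  k • v = Vec.map (k ℕ.*_) v

  ⊕-rawMonoid : RawMonoid 0ℓ 0ℓ
  ⊕-rawMonoid = record { Carrier = NodeVec ; _≈_ = _≡_ ; _∙_ = _⊕_ ; ε = 𝟘 }

  open FiniteSum ⊕-rawMonoid public using () renaming (∑ to ∑ᵥ; ∑∈ to ∑ᵥ∈)

  e : Node → NodeVec
  e k = 𝟘 [ k ]≔ 1

  𝒜 : Set
  𝒜 = 𝒟 × 𝒮

  eₐ : 𝒜 → NodeVec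
  eₐ (i , j) = e (d i) ⊕ e (s j)

  Balanced : NodeVec → Set
  Balanced q = ∑ℕ (λ i → lookup q (d i)) ≡ ∑ℕ (λ j → lookup q (s j))

  𝒬 : Set
  𝒬 = Σ NodeVec Balanced

  𝒴 : Set
  𝒴 = 𝒬 × 𝒜

  -- Only the entries of m at edges enter; they are the numbers u₍ᵢ,ⱼ₎.
  fromEdges : (𝒟 → 𝒮 → ℕ) → NodeVec
  fromEdges m = ∑ᵥ λ i → ∑ᵥ∈ 𝒮⟨ i ⟩ λ j → m i j • eₐ (i , j)

  infix 4 _∈U_

  _∈U_ : NodeVec → 𝒬 → Set
  u ∈U (x , _) = ∃ λ (m : 𝒟 → 𝒮 → ℕ) →
    u ≡ fromEdges m ×
    (∀ i → ∑ℕ∈ 𝒮⟨ i ⟩ (λ k → m i k) ℕ.≤ lookup x (d i)) ×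
    (∀ j → ∑ℕ∈ 𝒟⟨ j ⟩ (λ k → m k j) ℕ.≤ lookup x (s j))

  DecisionRule : Set
  DecisionRule = (x : 𝒬) → ∃ λ u → u ∈U x

  Policy : Set
  Policy = ℕ → DecisionRule

  stationary : DecisionRule → Policy
  stationary rule _ = rule

  MatchesEverything : DecisionRule → Set
  MatchesEverything rule = ∀ x → proj₁ x ⊖ proj₁ (rule x) ≡ 𝟘

  private
    open SumProperties ℕ.+-0-commutativeMonoid
      using (∑-distrib-+; ∑-comm; sum-cong-≗; sum-replicate-zero)

    d≢s : ∀ i j → d i ≢ s j
    d≢s i j eq with trans (sym (Fin.splitAt-↑ˡ n𝒟 i n𝒮))
                          (trans (cong (Fin.splitAt n𝒟) eq) (Fin.splitAt-↑ʳ n𝒟 n𝒮 j))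
    ... | ()

    δ : ∀ {n} → Fin n → Fin n → ℕ
    δ k l = lookup (replicate _ 0 [ k ]≔ 1) l

    lookup-e-≢ : ∀ {k l} → k ≢ l → lookup (e k) l ≡ 0
    lookup-e-≢ {k} {l} k≢l =
      trans (Vec.lookup∘update′ (λ l≡k → k≢l (sym l≡k)) 𝟘 1) (Vec.lookup-replicate l 0)

    sum-update : ∀ n (k : Fin n) (f : Fin n → ℕ) → (∀ l → k ≢ l → f l ≡ 0) → ∑ℕ f ≡ f k
    sum-update (suc n) Fin.zero f f≡0 = trans
      (cong (f Fin.zero ℕ.+_)
        (trans (sum-cong-≗ {n} (λ l → f≡0 (Fin.suc l) λ ())) (sum-replicate-zero n)))
      (ℕ.+-identityʳ _)
    sum-update (suc n) (Fin.suc k) f f≡0 = cong₂ ℕ._+_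
      (f≡0 Fin.zero λ ())
      (sum-update n k (λ l → f (Fin.suc l)) λ l k≢l → f≡0 (Fin.suc l) λ eq → k≢l (Fin.suc-injective eq))

    lookup-∑ᵥ : ∀ {n} (f : Fin n → NodeVec) l → lookup (∑ᵥ f) l ≡ ∑ℕ (λ k → lookup (f k) l)
    lookup-∑ᵥ {zero}  f l = Vec.lookup-replicate l 0
    lookup-∑ᵥ {suc n} f l = trans
      (Vec.lookup-zipWith ℕ._+_ l (f Fin.zero) _)
      (cong (lookup (f Fin.zero) l ℕ.+_) (lookup-∑ᵥ (λ k → f (Fin.suc k)) l))

    weight : (𝒟 → 𝒮 → ℕ) → 𝒟 → 𝒮 → ℕ
    weight m i j = if edge i j then m i j else 0

    lookup-term : ∀ m i j l →
      lookup (if lookup 𝒮⟨ i ⟩ j then m i j • eₐ (i , j) else 𝟘) l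
      ≡ weight m i j ℕ.* (lookup (e (d i)) l ℕ.+ lookup (e (s j)) l)
    lookup-term m i j l rewrite Vec.lookup∘tabulate (edge i) j with edge i j
    ... | true  = trans (Vec.lookup-map l (m i j ℕ.*_) (eₐ (i , j)))
                        (cong (m i j ℕ.*_) (Vec.lookup-zipWith ℕ._+_ l (e (d i)) (e (s j))))
    ... | false = Vec.lookup-replicate l 0

    lookup-fromEdges : ∀ m l → lookup (fromEdges m) l ≡
      ∑ℕ λ i → ∑ℕ λ j → weight m i j ℕ.* (lookup (e (d i)) l ℕ.+ lookup (e (s j)) l)
    lookup-fromEdges m l = trans
      (lookup-∑ᵥ (λ i → ∑ᵥ∈ 𝒮⟨ i ⟩ λ j → m i j • eₐ (i , j)) l)
      (sum-cong-≗ {n𝒟} λ i → trans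
        (lookup-∑ᵥ (λ j → if lookup 𝒮⟨ i ⟩ j then m i j • eₐ (i , j) else 𝟘) l)
        (sum-cong-≗ {n𝒮} λ j → lookup-term m i j l))

    lookup-e-d : ∀ i → lookup (e (d i)) (d i) ≡ 1
    lookup-e-d i = Vec.lookup∘update (d i) 𝟘 1

    lookup-e-s : ∀ j → lookup (e (s j)) (s j) ≡ 1
    lookup-e-s j = Vec.lookup∘update (s j) 𝟘 1

    d-≢ : ∀ {i i′} → i ≢ i′ → d i ≢ d i′
    d-≢ i≢ eq = i≢ (Fin.↑ˡ-injective n𝒮 _ _ eq)

    s-≢ : ∀ {j j′} → j ≢ j′ → s j ≢ s j′
    s-≢ j≢ eq = j≢ (Fin.↑ʳ-injective n𝒟 _ _ eq)

    sum-zero : ∀ n (f : Fin n → ℕ) → (∀ k → f k ≡ 0) → ∑ℕ f ≡ 0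
    sum-zero n f f≡0 = trans (sum-cong-≗ {n} f≡0) (sum-replicate-zero n)

  lookup-fromEdges-d : ∀ m i → lookup (fromEdges m) (d i) ≡ ∑ℕ∈ 𝒮⟨ i ⟩ (m i)
  lookup-fromEdges-d m i = trans (lookup-fromEdges m (d i)) (trans
    (sum-update n𝒟 i _ λ i′ i≢i′ → sum-zero n𝒮 _ λ j → trans
      (cong₂ (λ a b → weight m i′ j ℕ.* (a ℕ.+ b))
        (lookup-e-≢ (d-≢ λ eq → i≢i′ (sym eq)))
        (lookup-e-≢ λ eq → d≢s i j (sym eq)))
      (ℕ.*-zeroʳ (weight m i′ j)))
    (sum-cong-≗ {n𝒮} λ j → trans
      (cong₂ (λ a b → weight m i j ℕ.* (a ℕ.+ b))
        (lookup-e-d i) (lookup-e-≢ λ eq → d≢s i j (sym eq)))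
      (trans (ℕ.*-identityʳ (weight m i j))
        (cong (if_then m i j else 0) (sym (Vec.lookup∘tabulate (edge i) j))))))

  lookup-fromEdges-s : ∀ m j → lookup (fromEdges m) (s j) ≡ ∑ℕ∈ 𝒟⟨ j ⟩ (λ i → m i j)
  lookup-fromEdges-s m j = trans (lookup-fromEdges m (s j))
    (sum-cong-≗ {n𝒟} λ i → trans
      (sum-update n𝒮 j _ λ j′ j≢j′ → trans
        (cong₂ (λ a b → weight m i j′ ℕ.* (a ℕ.+ b))
          (lookup-e-≢ (d≢s i j))
          (lookup-e-≢ (s-≢ λ eq → j≢j′ (sym eq))))
        (ℕ.*-zeroʳ (weight m i j′)))
      (trans
        (cong₂ (λ a b → weight m i j ℕ.* (a ℕ.+ b))
          (lookup-e-≢ (d≢s i j)) (lookup-e-s j))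
        (trans (ℕ.*-identityʳ (weight m i j))
          (cong (if_then m i j else 0) (sym (Vec.lookup∘tabulate (λ i → edge i j) i))))))

  fromEdges-balanced : ∀ m → Balanced (fromEdges m)
  fromEdges-balanced m = let open ≡-Reasoning in begin
    ∑ℕ (λ i → lookup (fromEdges m) (d i))
      ≡⟨ sum-cong-≗ {n𝒟} (λ i → trans (lookup-fromEdges-d m i) (sum-cong-≗ {n𝒮} λ j →
           cong (if_then m i j else 0) (Vec.lookup∘tabulate (edge i) j))) ⟩
    ∑ℕ (λ i → ∑ℕ (weight m i))
      ≡⟨ ∑-comm (weight m) ⟩
    ∑ℕ (λ j → ∑ℕ (λ i → weight m i j))
      ≡⟨ sum-cong-≗ {n𝒮} (λ j → trans (lookup-fromEdges-s m j) (sum-cong-≗ {n𝒟} λ i →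
           cong (if_then m i j else 0) (Vec.lookup∘tabulate (λ i → edge i j) i))) ⟨
    ∑ℕ (λ j → lookup (fromEdges m) (s j)) ∎

  u≤x : ∀ {u} x → u ∈U x → ∀ k → lookup u k ℕ.≤ lookup (proj₁ x) k
  u≤x x (m , refl , rows , cols) k with Fin.splitAt n𝒟 k in eq
  ... | inj₁ i = subst (λ k → lookup (fromEdges m) k ℕ.≤ lookup (proj₁ x) k)
                   (Fin.splitAt⁻¹-↑ˡ eq)
                   (subst (ℕ._≤ _) (sym (lookup-fromEdges-d m i)) (rows i))
  ... | inj₂ j = subst (λ k → lookup (fromEdges m) k ℕ.≤ lookup (proj₁ x) k)
                   (Fin.splitAt⁻¹-↑ʳ eq)
                   (subst (ℕ._≤ _) (sym (lookup-fromEdges-s m j)) (cols j))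

  private
    eₐ-balanced : ∀ a → Balanced (eₐ a)
    eₐ-balanced (i , j) = trans
      (trans (sum-update n𝒟 i _ λ i′ i≢i′ → trans (split (d i′))
               (cong₂ ℕ._+_ (lookup-e-≢ (d-≢ i≢i′)) (lookup-e-≢ λ eq → d≢s i′ j (sym eq))))
             (trans (split (d i)) (cong₂ ℕ._+_ (lookup-e-d i) (lookup-e-≢ λ eq → d≢s i j (sym eq)))))
      (sym
      (trans (sum-update n𝒮 j _ λ j′ j≢j′ → trans (split (s j′))
               (cong₂ ℕ._+_ (lookup-e-≢ (d≢s i j′)) (lookup-e-≢ (s-≢ j≢j′))))
             (trans (split (s j)) (cong₂ ℕ._+_ (lookup-e-≢ (d≢s i j)) (lookup-e-s j)))))
      where
      split : ∀ k → lookup (eₐ (i , j)) k ≡ lookup (e (d i)) k ℕ.+ lookup (e (s j)) k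
      split k = Vec.lookup-zipWith ℕ._+_ k (e (d i)) (e (s j))

    ∑-⊕ : ∀ {n} (at : Fin n → Node) v w →
          ∑ℕ (λ k → lookup (v ⊕ w) (at k))
          ≡ ∑ℕ (λ k → lookup v (at k)) ℕ.+ ∑ℕ (λ k → lookup w (at k))
    ∑-⊕ {n} at v w = trans
      (sum-cong-≗ {n} λ k → Vec.lookup-zipWith ℕ._+_ (at k) v w)
      (∑-distrib-+ (λ k → lookup v (at k)) (λ k → lookup w (at k)))

    ∑-⊖ : ∀ {n} (at : Fin n → Node) v w → (∀ k → lookup w k ℕ.≤ lookup v k) →
          ∑ℕ (λ k → lookup (v ⊖ w) (at k)) ℕ.+ ∑ℕ (λ k → lookup w (at k))
          ≡ ∑ℕ (λ k → lookup v (at k))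
    ∑-⊖ {n} at v w w≤v = trans
      (sym (∑-distrib-+ (λ k → lookup (v ⊖ w) (at k)) (λ k → lookup w (at k))))
      (sum-cong-≗ {n} λ k → trans
        (cong (ℕ._+ lookup w (at k)) (Vec.lookup-zipWith _∸_ (at k) v w))
        (ℕ.m∸n+n≡m (w≤v (at k))))

  arrive : 𝒴 → 𝒬
  arrive ((q , q-bal) , a) =
    q ⊕ eₐ a ,
    trans (∑-⊕ d q (eₐ a)) (trans (cong₂ ℕ._+_ q-bal (eₐ-balanced a)) (sym (∑-⊕ s q (eₐ a))))

  match : (x : 𝒬) → (∃ λ u → u ∈U x) → 𝒬
  match (x , x-bal) (u , u∈U) =
    x ⊖ u ,
    ℕ.+-cancelʳ-≡ (∑ℕ (λ i → lookup u (d i))) _ _ (trans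
      (∑-⊖ d x u u≤)
      (trans x-bal (trans
        (sym (∑-⊖ s x u u≤))
        (cong (∑ℕ (λ j → lookup (x ⊖ u) (s j)) ℕ.+_) (sym u-bal)))))
    where
    u≤ : ∀ k → lookup u k ℕ.≤ lookup x k
    u≤ = u≤x (x , x-bal) u∈U

    u-bal : Balanced u
    u-bal = subst Balanced (sym (proj₁ (proj₂ u∈U))) (fromEdges-balanced (proj₁ u∈U))

  -- run π n y (a₁ ∷ … ∷ aₘ ∷ []) is Y(n+m) when Y(n) = y and the arrivals at
  -- times n+1, …, n+m are a₁, …, aₘ.
  run : ∀ {m} → Policy → ℕ → 𝒴 → Vec 𝒜 m → 𝒴
  run π n y []      = y
  run π n y (a ∷ w) = run π (suc n) (match x (π n x) , a) w
    where
    x : 𝒬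
    x = arrive y

record MatchingModel : Set where
  field
    graph : BipartiteGraph

  open BipartiteGraph graph public

  field
    α : 𝒟 → ℝ
    β : 𝒮 → ℝ
    c : Node → ℝ

    αβ>0 : ∀ i j → 0ℝ <ℝ α i *ℝ β j
    ∑α≈1 : ∑ℝ α ≈ℝ 1ℝ
    ∑β≈1 : ∑ℝ β ≈ℝ 1ℝ
    c>0  : ∀ k → 0ℝ <ℝ c k

    stable-𝒟 : ∀ (D : Subset n𝒟) → Nonempty D → D ⊂ ⊤ → ∑ℝ∈ D α <ℝ ∑ℝ∈ 𝒮[ D ] β
    stable-𝒮 : ∀ (S : Subset n𝒮) → Nonempty S → S ⊂ ⊤ → ∑ℝ∈ S β <ℝ ∑ℝ∈ 𝒟[ S ] α

  cost : 𝒴 → ℝ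
  cost y = ∑ℝ λ k → c k *ℝ fromℕ (lookup (proj₁ (arrive y)) k)

  ℙ : ∀ {n} → Vec 𝒜 n → ℝ
  ℙ []            = 1ℝ
  ℙ ((i , j) ∷ w) = (α i *ℝ β j) *ℝ ℙ w

  ∑𝒜^ : ∀ n → (Vec 𝒜 n → ℝ) → ℝ
  ∑𝒜^ zero    f = f []
  ∑𝒜^ (suc n) f = ∑ℝ λ i → ∑ℝ λ j → ∑𝒜^ n λ w → f ((i , j) ∷ w)

  -- 𝔼cost π y n = 𝔼_y^π[c(Y(n))]: Y(0) = y is fixed, so Y(n) is a function of
  -- the n independent arrivals at times 1, …, n.
  𝔼cost : Policy → 𝒴 → ℕ → ℝ
  𝔼cost π y n = ∑𝒜^ n λ w → ℙ w *ℝ cost (run π 0 y w)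

  -- Entry m is the average over N = m + 1 steps.
  averages : Policy → 𝒴 → ℕ → ℝ
  averages π y m =
    fromℚ (+ 1 ℚ./ suc m) *ℝ ∑ℝ {suc m} λ n → 𝔼cost π y (toℕ n)

  g : Policy → 𝒴 → ℝ̄
  g π y = limsup (averages π y)

  g* : 𝒴 → ℝ̄
  g* y = inf λ π → g π y

-- Matching everything empties the queues at each step, so along every sequence
-- of arrivals the resulting state is componentwise at most the state reached
-- under any other policy.  Hence all expected costs, and with them the limsup
-- of their averages, are minimal.  A rule that matches everything exists since
-- on a complete graph its matchings are the nonnegative integer matrices with
-- prescribed, equally large, row and column sums.

{-# OPTIONS --safe #-}
module Submission where

open import Defs
import Algebra.Properties.CommutativeMonoid.Sum as SumProperties
open import Data.Bool.Base using (if_then_else_)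
open import Data.Fin.Base as Fin using (Fin; toℕ)
import Data.Fin.Properties as Fin
open import Data.Integer.Base as ℤ using (+_)
import Data.Integer.Properties as ℤ
open import Data.Nat
  using (ℕ; zero; suc; _+_; _∸_; _⊓_; _⊔_; _≤_; z≤n; +-0-rawMonoid)
import Data.Nat.Properties as ℕ
open import Data.Product using (Σ; ∃; _×_; _,_; proj₁; proj₂)
open import Data.Rational.Base as ℚ using (ℚ; 0ℚ)
import Data.Rational.Properties as ℚ
open import Data.Rational.Unnormalised.Base as ℚᵘ using (mkℚᵘ)
import Data.Rational.Unnormalised.Properties as ℚᵘ
open import Data.Sum.Base using (inj₁; inj₂)
open import Data.Vec.Base using (Vec; []; _∷_; lookup)
open import Data.Vec.Properties using (lookup-zipWith; lookup-replicate; lookup∘tabulate)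
open import Data.Vec.Relation.Binary.Pointwise.Extensional using (ext; Pointwise-≡⇒≡)
open import Relation.Binary.PropositionalEquality
  using (_≡_; refl; sym; trans; cong; subst; subst₂; module ≡-Reasoning)

open FiniteSum +-0-rawMonoid using () renaming (∑ to ∑ℕ; ∑∈ to ∑ℕ∈)
open SumProperties ℕ.+-0-commutativeMonoid using (∑-distrib-+; sum-cong-≗)

-- Eventual order of representing sequences.

infix 4 _≤ᵉ_

-- Stronger than the order of the reals, since it depends on the representing
-- sequences, but all sums and products compared here satisfy it.
_≤ᵉ_ : ℝ → ℝ → Set
x ≤ᵉ y = ∃ λ N → ∀ n → N ≤ n → seq x n ℚ.≤ seq y n

≤ᵉ-refl : ∀ {x} → x ≤ᵉ x
≤ᵉ-refl = 0 , λ _ _ → ℚ.≤-refl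

<ℝ⇒≤ᵉ : ∀ {x y} → x <ℝ y → x ≤ᵉ y
<ℝ⇒≤ᵉ {x} (ε , 0<ε , N , x+ε≤y) = N , λ n N≤n →
  ℚ.≤-trans (subst (ℚ._≤ seq x n ℚ.+ ε) (ℚ.+-identityʳ (seq x n))
              (ℚ.+-monoʳ-≤ (seq x n) (ℚ.<⇒≤ 0<ε)))
            (x+ε≤y n N≤n)

+ℝ-mono-≤ᵉ : ∀ {x y u v} → x ≤ᵉ y → u ≤ᵉ v → x +ℝ u ≤ᵉ y +ℝ v
+ℝ-mono-≤ᵉ (M , x≤y) (N , u≤v) = M ⊔ N , λ n K≤n →
  ℚ.+-mono-≤ (x≤y n (ℕ.m⊔n≤o⇒m≤o M N K≤n)) (u≤v n (ℕ.m⊔n≤o⇒n≤o M N K≤n))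

*ℝ-monoˡ-≤ᵉ : ∀ z {x y} → 0ℝ ≤ᵉ z → x ≤ᵉ y → z *ℝ x ≤ᵉ z *ℝ y
*ℝ-monoˡ-≤ᵉ z (M , 0≤z) (N , x≤y) = M ⊔ N , λ n K≤n →
  ℚ.*-monoˡ-≤-nonNeg (seq z n) {{ℚ.nonNegative (0≤z n (ℕ.m⊔n≤o⇒m≤o M N K≤n))}}
    (x≤y n (ℕ.m⊔n≤o⇒n≤o M N K≤n))

*ℝ-nonNeg : ∀ x y → 0ℝ ≤ᵉ x → 0ℝ ≤ᵉ y → 0ℝ ≤ᵉ x *ℝ y
*ℝ-nonNeg x y 0≤x 0≤y with *ℝ-monoˡ-≤ᵉ x {0ℝ} {y} 0≤x 0≤y
... | N , x0≤xy = N , λ n N≤n → subst (ℚ._≤ seq x n ℚ.* seq y n) (ℚ.*-zeroʳ (seq x n)) (x0≤xy n N≤n)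

∑ℝ-mono-≤ᵉ : ∀ {n} (f g : Fin n → ℝ) → (∀ i → f i ≤ᵉ g i) → ∑ℝ f ≤ᵉ ∑ℝ g
∑ℝ-mono-≤ᵉ {zero}  f g f≤g = ≤ᵉ-refl {0ℝ}
∑ℝ-mono-≤ᵉ {suc n} f g f≤g = +ℝ-mono-≤ᵉ
  {f Fin.zero} {g Fin.zero} {∑ℝ λ i → f (Fin.suc i)} {∑ℝ λ i → g (Fin.suc i)}
  (f≤g Fin.zero) (∑ℝ-mono-≤ᵉ (λ i → f (Fin.suc i)) (λ i → g (Fin.suc i)) λ i → f≤g (Fin.suc i))

fromℚ-mono-≤ᵉ : ∀ {p q} → p ℚ.≤ q → fromℚ p ≤ᵉ fromℚ q
fromℚ-mono-≤ᵉ p≤q = 0 , λ _ _ → p≤q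

fromℕ-mono-≤ᵉ : ∀ {m n} → m ≤ n → fromℕ m ≤ᵉ fromℕ n
-- `+ m ℚ./ 1` is the normalisation of `mkℚᵘ (+ m) 0`; on unnormalised fractions the claim is a
-- cross multiplication by 1.
fromℕ-mono-≤ᵉ {m} {n} m≤n = fromℚ-mono-≤ᵉ (ℚ.toℚᵘ-cancel-≤
  (ℚᵘ.≤-respˡ-≃ (ℚᵘ.≃-sym (ℚ.toℚᵘ-fromℚᵘ (mkℚᵘ (+ m) 0)))
  (ℚᵘ.≤-respʳ-≃ (ℚᵘ.≃-sym (ℚ.toℚᵘ-fromℚᵘ (mkℚᵘ (+ n) 0)))
  (ℚᵘ.*≤* (ℤ.*-monoʳ-≤-nonNeg (+ 1) (ℤ.+≤+ m≤n))))))

ι-mono : ∀ {x y} → x ≤ᵉ y → ι x ≤∞ ι y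
ι-mono (M , x≤y) q (ε , 0<ε , N , y+ε≤q) = ε , 0<ε , M ⊔ N , λ n K≤n →
  ℚ.≤-trans (ℚ.+-monoˡ-≤ ε (x≤y n (ℕ.m⊔n≤o⇒m≤o M N K≤n)))
            (y+ε≤q n (ℕ.m⊔n≤o⇒n≤o M N K≤n))

-- The shape to which averages reduces: f₀ are the node costs at time 0, where
-- the probability factor is 1, and f are the expected costs at times 1, …, k.
average : ∀ {l k} → (Fin l → ℝ) → (Fin k → ℝ) → ℝ
average {k = k} f₀ f = fromℚ (+ 1 ℚ./ suc k) *ℝ (1ℝ *ℝ ∑ℝ f₀ +ℝ ∑ℝ f)

-- The conclusion is Below (ι (average f₀ f)) p.  It is unfolded since an explicit
-- Σ makes Agda solve f₀ and f from the goal before it checks the arguments.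
average-mono-Below : ∀ {l k} {f₀ g₀ : Fin l → ℝ} {f g : Fin k → ℝ} {p} →
  Below (ι (average g₀ g)) p → (∀ i → f₀ i ≤ᵉ g₀ i) → (∀ i → f i ≤ᵉ g i) →
  Σ ℚ λ ε → Σ (0ℚ ℚ.< ε) λ _ → Σ ℕ λ N → ∀ n → N ≤ n → seq (average f₀ f) n ℚ.+ ε ℚ.≤ p
average-mono-Below {l} {k} {f₀} {g₀} {f} {g} {p} g<p f₀≤g₀ f≤g =
  ι-mono {average f₀ f} {average g₀ g}
    (*ℝ-monoˡ-≤ᵉ (fromℚ (+ 1 ℚ./ suc k))
      {1ℝ *ℝ ∑ℝ f₀ +ℝ ∑ℝ f} {1ℝ *ℝ ∑ℝ g₀ +ℝ ∑ℝ g}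
      (fromℚ-mono-≤ᵉ (ℚ.nonNegative⁻¹ (+ 1 ℚ./ suc k) {{ℚ.normalize-nonNeg 1 (suc k)}}))
      (+ℝ-mono-≤ᵉ {1ℝ *ℝ ∑ℝ f₀} {1ℝ *ℝ ∑ℝ g₀} {∑ℝ f} {∑ℝ g}
        (*ℝ-monoˡ-≤ᵉ 1ℝ {∑ℝ f₀} {∑ℝ g₀}
          (fromℚ-mono-≤ᵉ (ℚ.nonNegative⁻¹ ℚ.1ℚ)) (∑ℝ-mono-≤ᵉ f₀ g₀ f₀≤g₀))
        (∑ℝ-mono-≤ᵉ f g f≤g)))
    p g<p

-- Integer matrices with prescribed margins.

-- Greedy choice: the first entry takes as much of `t` as it can, and the tail has room for the
-- rest, `t ∸ y Fin.zero`.
subvector-with-sum : ∀ {n} (y : Fin n → ℕ) t → t ≤ ∑ℕ y →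
                     ∃ λ (r : Fin n → ℕ) → (∀ j → r j ≤ y j) × ∑ℕ r ≡ t
subvector-with-sum {zero}  y .0 z≤n = y , (λ ()) , refl
subvector-with-sum {suc n} y t t≤∑y
  with subvector-with-sum (λ j → y (Fin.suc j)) (t ∸ y Fin.zero)
         (ℕ.m≤n+o⇒m∸n≤o t (y Fin.zero) t≤∑y)
... | r , r≤y , ∑r =
  (λ { Fin.zero → y Fin.zero ⊓ t ; (Fin.suc j) → r j }) ,
  (λ { Fin.zero → ℕ.m⊓n≤m (y Fin.zero) t ; (Fin.suc j) → r≤y j }) ,
  trans (cong (λ e → y Fin.zero ⊓ t + e) ∑r) (ℕ.m⊓n+n∸m≡n (y Fin.zero) t)

-- Row by row: the first row takes its total out of the column totals `y`, and the remaining rows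
-- have to fill what is left of them.
matrix-with-margins : ∀ {m n} (x : Fin m → ℕ) (y : Fin n → ℕ) → ∑ℕ x ≡ ∑ℕ y →
                      ∃ λ (M : Fin m → Fin n → ℕ) →
                      (∀ i → ∑ℕ (M i) ≡ x i) × (∀ j → ∑ℕ (λ i → M i j) ≡ y j)
matrix-with-margins {zero} x y 0≡∑y = (λ ()) , (λ ()) , ∑≡0⇒≡0 y (sym 0≡∑y)
  where
  ∑≡0⇒≡0 : ∀ {n} (y : Fin n → ℕ) → ∑ℕ y ≡ 0 → ∀ j → 0 ≡ y j
  ∑≡0⇒≡0 y ∑y≡0 Fin.zero    = sym (ℕ.m+n≡0⇒m≡0 (y Fin.zero) ∑y≡0)
  ∑≡0⇒≡0 y ∑y≡0 (Fin.suc j) =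
    ∑≡0⇒≡0 (λ j → y (Fin.suc j)) (ℕ.m+n≡0⇒n≡0 (y Fin.zero) ∑y≡0) j
matrix-with-margins {suc m} {n} x y ∑x≡∑y
  with subvector-with-sum y (x Fin.zero) (subst (x Fin.zero ≤_) ∑x≡∑y (ℕ.m≤m+n (x Fin.zero) _))
... | r , r≤y , ∑r
  with matrix-with-margins (λ i → x (Fin.suc i)) (λ j → y j ∸ r j) ∑x′≡∑y′
  where
  open ≡-Reasoning

  ∑x′≡∑y′ : ∑ℕ (λ i → x (Fin.suc i)) ≡ ∑ℕ (λ j → y j ∸ r j)
  ∑x′≡∑y′ = ℕ.+-cancelˡ-≡ (x Fin.zero) _ _ (begin
    ∑ℕ x                           ≡⟨ ∑x≡∑y ⟩
    ∑ℕ y                           ≡⟨ sum-cong-≗ {n} (λ j → ℕ.m+[n∸m]≡n (r≤y j)) ⟨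
    ∑ℕ (λ j → r j + (y j ∸ r j))   ≡⟨ ∑-distrib-+ r (λ j → y j ∸ r j) ⟩
    ∑ℕ r + ∑ℕ (λ j → y j ∸ r j)    ≡⟨ cong (_+ _) ∑r ⟩
    x Fin.zero + ∑ℕ (λ j → y j ∸ r j) ∎)
... | M , rows , cols =
  (λ { Fin.zero → r ; (Fin.suc i) → M i }) ,
  (λ { Fin.zero → ∑r ; (Fin.suc i) → rows i }) ,
  λ j → trans (cong (λ e → r j + e) (cols j)) (ℕ.m+[n∸m]≡n (r≤y j))

-- Comparison of runs, and the rule on a complete graph.

module _ (G : BipartiteGraph) where
  open BipartiteGraph G

  infix 4 _≤̄_

  _≤̄_ : NodeVec → NodeVec → Set
  v ≤̄ w = ∀ k → lookup v k ≤ lookup w k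

  𝟘-least : ∀ v → 𝟘 ≤̄ v
  𝟘-least v k = subst (_≤ lookup v k) (sym (lookup-replicate k 0)) z≤n

  ⊕-monoˡ : ∀ v w u → v ≤̄ w → (v ⊕ u) ≤̄ (w ⊕ u)
  ⊕-monoˡ v w u v≤w k = subst₂ _≤_
    (sym (lookup-zipWith _+_ k v u)) (sym (lookup-zipWith _+_ k w u))
    (ℕ.+-monoˡ-≤ (lookup u k) (v≤w k))

  -- Induction on the arrivals, common to both runs: each step of `π` leaves the queue `𝟘`, which
  -- lies below whatever queue `π′` leaves.
  run-least : ∀ π π′ → (∀ n → MatchesEverything (π n)) → ∀ {m} n {q q′ : 𝒬} a →
              proj₁ q ≤̄ proj₁ q′ → (w : Vec 𝒜 m) →
              proj₁ (arrive (run π n (q , a) w)) ≤̄ proj₁ (arrive (run π′ n (q′ , a) w))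
  run-least π π′ all n {q} {q′} a q≤q′ [] = ⊕-monoˡ (proj₁ q) (proj₁ q′) (eₐ a) q≤q′
  run-least π π′ all n {q} {q′} a q≤q′ (b ∷ w) = run-least π π′ all (suc n)
    {match x (π n x)} {match x′ (π′ n x′)} b
    (subst (_≤̄ proj₁ (match x′ (π′ n x′))) (sym (all n x)) (𝟘-least (proj₁ (match x′ (π′ n x′))))) w
    where
    x x′ : 𝒬
    x  = arrive (q , a)
    x′ = arrive (q′ , a)

  ∀-node : (P : Node → Set) → (∀ i → P (d i)) → (∀ j → P (s j)) → ∀ k → P k
  ∀-node P Pd Ps k with Fin.splitAt n𝒟 k in eq
  ... | inj₁ i = subst P (Fin.splitAt⁻¹-↑ˡ eq) (Pd i)
  ... | inj₂ j = subst P (Fin.splitAt⁻¹-↑ʳ eq) (Ps j)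

  complete⇒matchesEverything : Complete → ∃ MatchesEverything
  complete⇒matchesEverything complete = rule , all
    where
    ∑𝒮⟨⟩ : ∀ i (f : 𝒮 → ℕ) → ∑ℕ∈ 𝒮⟨ i ⟩ f ≡ ∑ℕ f
    ∑𝒮⟨⟩ i f = sum-cong-≗ {n𝒮} λ j → cong (if_then f j else 0)
      (trans (lookup∘tabulate (edge i) j) (complete i j))

    ∑𝒟⟨⟩ : ∀ j (f : 𝒟 → ℕ) → ∑ℕ∈ 𝒟⟨ j ⟩ f ≡ ∑ℕ f
    ∑𝒟⟨⟩ j f = sum-cong-≗ {n𝒟} λ i → cong (if_then f i else 0)
      (trans (lookup∘tabulate (λ i → edge i j) i) (complete i j))

    plan : (x : 𝒬) → ∃ λ (m : 𝒟 → 𝒮 → ℕ) →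
           (∀ i → ∑ℕ∈ 𝒮⟨ i ⟩ (m i) ≡ lookup (proj₁ x) (d i)) ×
           (∀ j → ∑ℕ∈ 𝒟⟨ j ⟩ (λ i → m i j) ≡ lookup (proj₁ x) (s j))
    plan (x , x-bal)
      with matrix-with-margins (λ i → lookup x (d i)) (λ j → lookup x (s j)) x-bal
    ... | m , rows , cols =
      m , (λ i → trans (∑𝒮⟨⟩ i (m i)) (rows i)) , λ j → trans (∑𝒟⟨⟩ j λ i → m i j) (cols j)

    rule : DecisionRule
    rule x = let m , rows , cols = plan x in
      fromEdges m , m , refl , (λ i → ℕ.≤-reflexive (rows i)) , λ j → ℕ.≤-reflexive (cols j)

    u≡x : ∀ x k → lookup (proj₁ (rule x)) k ≡ lookup (proj₁ x) k
    u≡x x = let m , rows , cols = plan x in ∀-node _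
      (λ i → trans (lookup-fromEdges-d m i) (rows i))
      (λ j → trans (lookup-fromEdges-s m j) (cols j))

    all : MatchesEverything rule
    all x = Pointwise-≡⇒≡ (ext λ k → let open ≡-Reasoning in begin
      lookup (proj₁ x ⊖ proj₁ (rule x)) k              ≡⟨ lookup-zipWith _∸_ k (proj₁ x) _ ⟩
      lookup (proj₁ x) k ∸ lookup (proj₁ (rule x)) k   ≡⟨ cong (lookup (proj₁ x) k ∸_) (u≡x x k) ⟩
      lookup (proj₁ x) k ∸ lookup (proj₁ x) k          ≡⟨ ℕ.n∸n≡0 (lookup (proj₁ x) k) ⟩
      0                                                ≡⟨ lookup-replicate k 0 ⟨
      lookup 𝟘 k                                       ∎)

-- Opening MatchingModel M would create copies of its names.  Applying the names
-- to M keeps terms syntactically equal to those of Defs; otherwise conversion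
-- checking η-expands the reals and compares their Cauchy proofs, which blows up.
module _ (M : MatchingModel) where
  open BipartiteGraph using (run; arrive; MatchesEverything; 𝒜)
  open MatchingModel
    using (graph; α; β; c; αβ>0; c>0; cost; ℙ; ∑𝒜^; 𝔼cost)

  -- Comparison of expected costs.

  ℙ-nonNeg : ∀ {n} (w : Vec (𝒜 (graph M)) n) → 0ℝ ≤ᵉ ℙ M w
  ℙ-nonNeg []            = fromℚ-mono-≤ᵉ (ℚ.nonNegative⁻¹ ℚ.1ℚ)
  ℙ-nonNeg ((i , j) ∷ w) = *ℝ-nonNeg (α M i *ℝ β M j) (ℙ M w)
    (<ℝ⇒≤ᵉ {0ℝ} {α M i *ℝ β M j} (αβ>0 M i j)) (ℙ-nonNeg w)

  cost-mono : ∀ y y′ → _≤̄_ (graph M) (proj₁ (arrive (graph M) y)) (proj₁ (arrive (graph M) y′)) →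
              cost M y ≤ᵉ cost M y′
  cost-mono y y′ y≤y′ = ∑ℝ-mono-≤ᵉ
    (λ k → c M k *ℝ fromℕ (lookup (proj₁ (arrive (graph M) y)) k))
    (λ k → c M k *ℝ fromℕ (lookup (proj₁ (arrive (graph M) y′)) k))
    λ k → *ℝ-monoˡ-≤ᵉ (c M k)
      {fromℕ (lookup (proj₁ (arrive (graph M) y)) k)}
      {fromℕ (lookup (proj₁ (arrive (graph M) y′)) k)}
      (<ℝ⇒≤ᵉ {0ℝ} {c M k} (c>0 M k)) (fromℕ-mono-≤ᵉ (y≤y′ k))

  ∑𝒜^-mono : ∀ n (f g : Vec (𝒜 (graph M)) n → ℝ) → (∀ w → f w ≤ᵉ g w) → ∑𝒜^ M n f ≤ᵉ ∑𝒜^ M n g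
  ∑𝒜^-mono zero    f g f≤g = f≤g []
  ∑𝒜^-mono (suc n) f g f≤g = ∑ℝ-mono-≤ᵉ
    (λ i → ∑ℝ λ j → ∑𝒜^ M n λ w → f ((i , j) ∷ w))
    (λ i → ∑ℝ λ j → ∑𝒜^ M n λ w → g ((i , j) ∷ w))
    λ i → ∑ℝ-mono-≤ᵉ
      (λ j → ∑𝒜^ M n λ w → f ((i , j) ∷ w))
      (λ j → ∑𝒜^ M n λ w → g ((i , j) ∷ w))
      λ j → ∑𝒜^-mono n (λ w → f ((i , j) ∷ w)) (λ w → g ((i , j) ∷ w)) λ w → f≤g ((i , j) ∷ w)

  -- The law of the arrivals does not depend on the policy, so each word `w` has the same
  -- nonnegative weight on both sides and the runs can be compared word by word.
  𝔼cost-least : ∀ {π π′} → (∀ n → MatchesEverything (graph M) (π n)) → ∀ y n →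
                𝔼cost M π y n ≤ᵉ 𝔼cost M π′ y n
  𝔼cost-least {π} {π′} all y n = ∑𝒜^-mono n
    (λ w → ℙ M w *ℝ cost M (run (graph M) π 0 y w))
    (λ w → ℙ M w *ℝ cost M (run (graph M) π′ 0 y w))
    λ w → *ℝ-monoˡ-≤ᵉ (ℙ M w)
      {cost M (run (graph M) π 0 y w)} {cost M (run (graph M) π′ 0 y w)}
      (ℙ-nonNeg w)
      (cost-mono (run (graph M) π 0 y w) (run (graph M) π′ 0 y w)
        (run-least (graph M) π π′ all 0 {proj₁ y} {proj₁ y} (proj₂ y) (λ _ → ℕ.≤-refl) w))

  -- 𝔼cost M π y (suc n) ≤ᵉ 𝔼cost M π′ y (suc n), unfolded as in average-mono-Below.
  𝔼cost-suc-least : ∀ {π π′ y n} → (∀ n → MatchesEverything (graph M) (π n)) →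
    Σ ℕ λ N → ∀ k → N ≤ k → seq (𝔼cost M π y (suc n)) k ℚ.≤ seq (𝔼cost M π′ y (suc n)) k
  𝔼cost-suc-least {π} {π′} {y} {n} all = 𝔼cost-least {π} {π′} all y (suc n)

theorem4 : (M : MatchingModel) → let open MatchingModel M in
    1 ≤ n𝒟 → 1 ≤ n𝒮 → Complete →
    (∃ λ (rule : DecisionRule) → MatchesEverything rule) ×
    (∀ (rule : DecisionRule) → MatchesEverything rule →
    ∀ (y : 𝒴) → g (stationary rule) y ≈∞ g* y)
-- For the same reason both inequalities are proved on the unfolded goal, in which
-- the policy `stationary rule` of the statement is found by unification.
theorem4 M _ _ complete =
  complete⇒matchesEverything (graph M) complete ,
  λ rule all y →
    -- If `q` exceeds `g*` because of `π`, the same `N` and `p` serve for `rule`.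
    (λ q (π , N , p , p<q , <p) → N , p , p<q , λ k →
      average-mono-Below {n𝒟 (graph M) + n𝒮 (graph M)} {N + k} (<p k)
        -- At time 0 both policies are in state `y`, so the node costs agree.
        (λ _ → 0 , λ _ _ → ℚ.≤-refl)
        (λ i → 𝔼cost-suc-least M {π′ = π} {y} {toℕ i} (λ _ → all))) ,
    -- The stationary policy itself is the witness for the infimum; its averages are compared with
    -- themselves.
    (λ q (N , p , p<q , <p) → stationary (graph M) rule , N , p , p<q , λ k →
      average-mono-Below {n𝒟 (graph M) + n𝒮 (graph M)} {N + k} (<p k)
        (λ _ → 0 , λ _ _ → ℚ.≤-refl)
        (λ i → 𝔼cost-suc-least M {stationary (graph M) rule} {y = y} {toℕ i} (λ _ → all)))
  where
  open BipartiteGraph using (n𝒟; n𝒮; stationary)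
  open MatchingModel using (graph)
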